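{- Let $T_1,T_2$ be stably infinite theories in disjoint signatures $\Sigma_1,\Sigma_2$. If $T_1$ and $T_2$ both have the strong sub-amalgamation property, then so does $T_1\cup T_2$.
   Context: A theory $T$ is stably infinite if every $T$-satisfiable quantifier-free formula is satisfiable in an infinite model of $T$. $T$ has the strong sub-amalgamation property if whenever $\mathcal M_1,\mathcal M_2$ are models of $T$ having a common substructure $\mathcal A$ (not necessarily a model of $T$), there exist a model $\mathcal M$ of $T$ and embeddings $\mu_1:\mathcal M_1\to\mathcal M$, $\mu_2:\mathcal M_2\to\mathcal M$ agreeing on the support of $\mathcal A$ and such that $\mu_1(|\mathcal M_1|)\cap\mu_2(|\mathcal M_2|)=\mu_1(|\mathcal A|)$ $(=\mu_2(|\mathcal A|))$, where $|\cdot|$ denotes the support. -}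

module Defs where

open import Data.Empty using (⊥)
open import Data.Fin.Base using (Fin)
open import Data.Nat.Base using (ℕ; suc)
open import Data.Product.Base using (_×_; ∃-syntax; Σ-syntax)
open import Data.Sum.Base using (_⊎_; inj₁; inj₂)
open import Data.Vec.Base using (Vec; []; _∷_; lookup; map)
open import Function.Base using (_∘_)
open import Function.Bundles using (_⇔_; _↔_)
open import Function.Definitions using (Injective)
open import Level using (0ℓ)
open import Relation.Binary.PropositionalEquality.Core using (_≡_)
open import Relation.Nullary.Negation.Core using (¬_)
open import Relation.Unary using (Pred; _∈_; _∩_; _≐_)

-- Symbols indexed by arity; constants are the function symbols of arity 0.
-- Equality is a logical symbol and so is not listed.
record Signature : Set₁ where
  field
    Fun : ℕ → Set
    Rel : ℕ → Set

open Signature public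

-- Terms and formulas whose free variables are among n (de Bruijn) variables.
-- The meta-theory of the statement is classical, so the connectives and
-- quantifiers other than ⊥, ⇒, ∀ are definable in the usual way.

data Term (S : Signature) (n : ℕ) : Set where
  var : Fin n → Term S n
  app : ∀ {k} → Fun S k → Vec (Term S n) k → Term S n

infixr 6 _`⇒_
infix  7 _`≡_

data Formula (S : Signature) : ℕ → Set where
  `⊥   : ∀ {n} → Formula S n
  _`≡_ : ∀ {n} → Term S n → Term S n → Formula S n
  atom : ∀ {n k} → Rel S k → Vec (Term S n) k → Formula S n
  _`⇒_ : ∀ {n} → Formula S n → Formula S n → Formula S n
  `∀_  : ∀ {n} → Formula S (suc n) → Formula S n

data QuantifierFree {S : Signature} {n : ℕ} : Pred (Formula S n) 0ℓ where
  `⊥   : QuantifierFree `⊥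
  _`≡_ : ∀ s t → QuantifierFree (s `≡ t)
  atom : ∀ {k} (R : Rel S k) ts → QuantifierFree (atom R ts)
  _`⇒_ : ∀ {φ ψ} → QuantifierFree φ → QuantifierFree ψ → QuantifierFree (φ `⇒ ψ)

Theory : Signature → Set₁
Theory S = Pred (Formula S 0) 0ℓ

-- Structures with an empty carrier are allowed: two models of a theory may
-- have an empty common substructure when there are no constants.
record Structure (S : Signature) : Set₁ where
  field
    Carrier : Set
    fun     : ∀ {k} → Fun S k → Vec Carrier k → Carrier
    rel     : ∀ {k} → Rel S k → Pred (Vec Carrier k) 0ℓ

∣_∣ : ∀ {S} → Structure S → Set
∣ M ∣ = Structure.Carrier M

module _ {S : Signature} (M : Structure S) where

  mutual
    eval : ∀ {n} → Vec ∣ M ∣ n → Term S n → ∣ M ∣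
    eval ρ (var i)    = lookup ρ i
    eval ρ (app f ts) = Structure.fun M f (evals ρ ts)

    evals : ∀ {n k} → Vec ∣ M ∣ n → Vec (Term S n) k → Vec ∣ M ∣ k
    evals ρ []       = []
    evals ρ (t ∷ ts) = eval ρ t ∷ evals ρ ts

  Satisfies : ∀ {n} → Vec ∣ M ∣ n → Formula S n → Set
  Satisfies ρ `⊥          = ⊥
  Satisfies ρ (s `≡ t)    = eval ρ s ≡ eval ρ t
  Satisfies ρ (atom R ts) = evals ρ ts ∈ Structure.rel M R
  Satisfies ρ (φ `⇒ ψ)    = Satisfies ρ φ → Satisfies ρ ψ
  Satisfies ρ (`∀ φ)      = ∀ x → Satisfies (x ∷ ρ) φ

infix 4 _⊨_

_⊨_ : ∀ {S} → Structure S → Theory S → Set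
M ⊨ T = ∀ φ → φ ∈ T → Satisfies M [] φ

Infinite : Set → Set
Infinite A = ¬ (∃[ n ] (A ↔ Fin n))

StablyInfinite : ∀ {S} → Theory S → Set₁
StablyInfinite {S} T =
  ∀ {n} (φ : Formula S n) → QuantifierFree φ →
  (∃[ M ] M ⊨ T × ∃[ ρ ] Satisfies M ρ φ) →
  ∃[ M ] M ⊨ T × Infinite ∣ M ∣ × ∃[ ρ ] Satisfies M ρ φ

record Embedding {S : Signature} (M N : Structure S) : Set where
  field
    to        : ∣ M ∣ → ∣ N ∣
    injective : Injective _≡_ _≡_ to
    fun-homo  : ∀ {k} (f : Fun S k) xs →
                to (Structure.fun M f xs) ≡ Structure.fun N f (map to xs)
    rel-homo  : ∀ {k} (R : Rel S k) xs →
                (xs ∈ Structure.rel M R) ⇔ (map to xs ∈ Structure.rel N R)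

Image : {A B : Set} → (A → B) → Pred B 0ℓ
Image f y = ∃[ x ] f x ≡ y

StronglyAmalgamates : ∀ {S} {A M₁ M₂ M : Structure S} →
  Embedding A M₁ → Embedding A M₂ → Embedding M₁ M → Embedding M₂ M → Set
StronglyAmalgamates ι₁ ι₂ μ₁ μ₂ =
  (∀ a → to μ₁ (to ι₁ a) ≡ to μ₂ (to ι₂ a)) ×
  (Image (to μ₁) ∩ Image (to μ₂)) ≐ Image (to μ₁ ∘ to ι₁)
  where open Embedding using (to)

-- A common substructure is given by its inclusions ι₁ and ι₂, rather than by
-- a subset of a set containing both carriers; it need not be a model of T.
StrongSubAmalgamation : ∀ {S} → Theory S → Set₁
StrongSubAmalgamation {S} T =
  ∀ {M₁ M₂ A : Structure S} → M₁ ⊨ T → M₂ ⊨ T →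
  (ι₁ : Embedding A M₁) (ι₂ : Embedding A M₂) →
  Σ[ M ∈ Structure S ] M ⊨ T ×
  Σ[ μ₁ ∈ Embedding M₁ M ] Σ[ μ₂ ∈ Embedding M₂ M ]
    StronglyAmalgamates ι₁ ι₂ μ₁ μ₂

-- The sum of two signatures represents the union of disjoint signatures.
infixr 5 _⊕_

_⊕_ : Signature → Signature → Signature
S₁ ⊕ S₂ = record
  { Fun = λ k → Fun S₁ k ⊎ Fun S₂ k
  ; Rel = λ k → Rel S₁ k ⊎ Rel S₂ k
  }

record SignatureMorphism (S S′ : Signature) : Set where
  field
    onFun : ∀ {k} → Fun S k → Fun S′ k
    onRel : ∀ {k} → Rel S k → Rel S′ k

inl : ∀ {S₁ S₂} → SignatureMorphism S₁ (S₁ ⊕ S₂)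
inl = record { onFun = inj₁ ; onRel = inj₁ }

inr : ∀ {S₁ S₂} → SignatureMorphism S₂ (S₁ ⊕ S₂)
inr = record { onFun = inj₂ ; onRel = inj₂ }

module _ {S S′ : Signature} (h : SignatureMorphism S S′) where
  open SignatureMorphism h

  mutual
    translateTerm : ∀ {n} → Term S n → Term S′ n
    translateTerm (var i)    = var i
    translateTerm (app f ts) = app (onFun f) (translateTerms ts)

    translateTerms : ∀ {n k} → Vec (Term S n) k → Vec (Term S′ n) k
    translateTerms []       = []
    translateTerms (t ∷ ts) = translateTerm t ∷ translateTerms ts

  translate : ∀ {n} → Formula S n → Formula S′ n
  translate `⊥          = `⊥
  translate (s `≡ t)    = translateTerm s `≡ translateTerm t
  translate (atom R ts) = atom (onRel R) (translateTerms ts)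
  translate (φ `⇒ ψ)    = translate φ `⇒ translate ψ
  translate (`∀ φ)      = `∀ translate φ

infixr 5 _∪ᵀ_

data _∪ᵀ_ {S₁ S₂ : Signature} (T₁ : Theory S₁) (T₂ : Theory S₂) :
          Theory (S₁ ⊕ S₂) where
  left  : ∀ {φ} → φ ∈ T₁ → translate inl φ ∈ (T₁ ∪ᵀ T₂)
  right : ∀ {φ} → φ ∈ T₂ → translate inr φ ∈ (T₁ ∪ᵀ T₂)

{-# OPTIONS --safe #-}
module Submission where

-- Amalgamate M₁ and M₂ over A separately for T₁ and for T₂.  Both amalgams
-- contain the set-theoretic pushout U of M₁ and M₂ over A, so it suffices to
-- replace each of them by a model with carrier U ⊎ X, for one and the same X:
-- the two models then combine into a model of T₁ ∪ᵀ T₂.  By compactness (here an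
-- ultraproduct) stable infiniteness adds arbitrarily many new elements to a
-- model, and a Skolem hull discards superfluous ones.  No cardinal arithmetic
-- is needed if X is the set of all trees labelled by the symbols and formulas
-- of both signatures and by the points of U: every element of the hull is named
-- by a tree, and the hull contains a copy of X outside U, so Cantor–Bernstein
-- identifies it with U ⊎ X.

open import Defs
open import Axiom.ExcludedMiddle using (ExcludedMiddle)
open import Axiom.Extensionality.Propositional using (Extensionality)
open import Axiom.UniquenessOfIdentityProofs.WithK using (uip)
open import Data.Bool.Base using (Bool; true; false; T)
open import Data.Bool.Properties using (T-irrelevant)
open import Data.Empty using (⊥; ⊥-elim)
open import Data.Fin.Base using (Fin; zero; suc)
open import Data.List.Base as List using (List; []; _∷_; _++_)
open import Data.List.Membership.Propositional using () renaming (_∈_ to _∈ˡ_)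
open import Data.List.Membership.Propositional.Properties
  using (∈-++⁺ˡ; ∈-++⁺ʳ; ∈-map⁺; ∈-concatMap⁺; ∈-lookup; ∈-deduplicate⁺)
open import Data.List.Relation.Binary.Subset.Propositional using () renaming (_⊆_ to _⊆ˡ_)
open import Data.List.Relation.Unary.All as All using (All; []; _∷_)
open import Data.List.Relation.Unary.All.Properties as All using (++⁺)
open import Data.List.Relation.Unary.Unique.Propositional using (Unique; []; _∷_)
open import Data.List.Relation.Unary.Unique.DecPropositional.Properties using (deduplicate-!)
open import Data.List.Relation.Unary.Any as Any using (here; there)
open import Data.List.Relation.Unary.Any.Properties as Any using (lookup-index)
open import Data.Maybe.Base using (Maybe; just; nothing; _>>=_)
open import Data.Nat.Base using (ℕ; zero; suc)
open import Data.Product.Base using (_×_; _,_; proj₁; proj₂; ∃; ∃-syntax; Σ-syntax)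
open import Data.Sum using (isInj₁; isInj₂)
open import Data.Sum.Base using (_⊎_; inj₁; inj₂; [_,_])
open import Data.Sum.Properties using (inj₁-injective; inj₂-injective)
open import Data.Unit.Base using (⊤; tt)
open import Data.Vec.Base as Vec using (Vec; []; _∷_; lookup; map)
open import Data.Vec.Properties using (lookup-map; map-∘)
open import Function.Base using (_∘_; id; _$_)
open import Function.Bundles using (_⇔_; mk⇔; mk↔ₛ′; module Equivalence)
open import Function.Definitions using (Injective)
open import Level using (0ℓ)
open import Relation.Binary.PropositionalEquality
  using (_≡_; _≢_; refl; sym; trans; cong; cong₂; subst)
open import Relation.Nullary.Decidable
  using (Dec; yes; no; toWitness; fromWitness; ⌊_⌋; decidable-stable)
open import Relation.Nullary.Negation using (¬_; contradiction)
open import Relation.Unary using (Pred; _∈_; ∁)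

module Classical
  (em : ∀ {a} → ExcludedMiddle a)
  (funext : ∀ {a b} → Extensionality a b)
  where

  -- Classical logic and Boolean truth values.

  ¬¬-elim : ∀ {a} {P : Set a} → ¬ ¬ P → P
  ¬¬-elim = decidable-stable em

  ¬∀⇒∃¬ : ∀ {a b} {A : Set a} {P : A → Set b} → ¬ (∀ x → P x) → ∃[ x ] ¬ P x
  ¬∀⇒∃¬ ¬∀ = ¬¬-elim λ ¬∃ → ¬∀ λ x → ¬¬-elim λ ¬p → ¬∃ (x , ¬p)

  -- Truth values in `Bool` keep families of subsets inside `Set`, and subsets with the same
  -- elements become equal by function extensionality and `T-ext`.
  ⟪_⟫ : ∀ {a} → Set a → Bool
  ⟪ P ⟫ = ⌊ em {P = P} ⌋

  ⟪⟫⁻ : ∀ {a} {P : Set a} → T ⟪ P ⟫ → P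
  ⟪⟫⁻ = toWitness {a? = em}

  ⟪⟫⁺ : ∀ {a} {P : Set a} → P → T ⟪ P ⟫
  ⟪⟫⁺ = fromWitness {a? = em}

  T-ext : ∀ {a b} → (T a → T b) → (T b → T a) → a ≡ b
  T-ext {false} {false} _ _ = refl
  T-ext {false} {true}  _ g = ⊥-elim (g tt)
  T-ext {true}  {false} f _ = ⊥-elim (f tt)
  T-ext {true}  {true}  _ _ = refl

  -- Maximal consistent sets

  -- OK is a property of finite sets; a set is consistent when all its finite
  -- subsets are OK.  The sets produced by adjoining one chosen element at a
  -- time and taking unions form a chain, whose union is maximal consistent.
  module Maximal {Y : Set} (OK : List Y → Set) (OK-[] : OK []) where

    Subset : Set
    Subset = Y → Bool

    infix 4 _⊆_
    _⊆_ : Subset → Subset → Set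
    F ⊆ G = ∀ y → T (F y) → T (G y)

    ⊆-antisym : ∀ {F G} → F ⊆ G → G ⊆ F → F ≡ G
    ⊆-antisym F⊆G G⊆F = funext λ y → T-ext (F⊆G y) (G⊆F y)

    Consistent : Subset → Set
    Consistent F = ∀ {ys} → All (T ∘ F) ys → OK ys

    insert : Y → Subset → Subset
    insert y F z = ⟪ T (F z) ⊎ z ≡ y ⟫

    Extensible : Subset → Y → Set
    Extensible F y = ¬ T (F y) × Consistent (insert y F)

    -- Matching on the fixed function `em` doubles as a choice operator: the element adjoined
    -- depends on `F` alone.
    extend : Subset → Subset
    extend F with em {P = ∃ (Extensible F)}
    ... | yes (y , _) = insert y F
    ... | no _        = F

    extend-inflationary : ∀ F → F ⊆ extend F
    extend-inflationary F z z∈F with em {P = ∃ (Extensible F)}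
    ... | yes _ = ⟪⟫⁺ (inj₁ z∈F)
    ... | no _  = z∈F

    extend-consistent : ∀ F → Consistent F → Consistent (extend F)
    extend-consistent F con with em {P = ∃ (Extensible F)}
    ... | yes (_ , _ , con′) = con′
    ... | no _               = con

    extend-closed : ∀ F → extend F ⊆ F → ¬ ∃ (Extensible F)
    extend-closed F closed ∃ext with em {P = ∃ (Extensible F)}
    ... | yes (y , y∉F , _) = y∉F (closed y (⟪⟫⁺ (inj₂ refl)))
    ... | no ∄ext           = ∄ext ∃ext

    ⋃ : (Subset → Bool) → Subset
    ⋃ C y = ⟪ (∃[ F ] T (C F) × T (F y)) ⟫

    data Tower : Subset → Set where
      step  : ∀ {F} → Tower F → Tower (extend F)
      union : ∀ C → (∀ {F} → T (C F) → Tower F) → Tower (⋃ C)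

    -- The comparison lemma behind Zermelo's and Bourbaki-Witt's arguments. As `extend` need not be
    -- monotone, the step case also compares in the opposite order, which either finishes or yields
    -- `F ≡ G`.
    tower-compare : ∀ {F G} → Tower F → Tower G → F ⊆ G ⊎ extend G ⊆ F
    tower-compare (step {F} p) q with tower-compare p q
    ... | inj₂ G′⊆F = inj₂ λ y → extend-inflationary F y ∘ G′⊆F y
    ... | inj₁ F⊆G with tower-compare q p
    ...   | inj₂ F′⊆G = inj₁ F′⊆G
    ...   | inj₁ G⊆F  = inj₂ (subst (λ H → extend H ⊆ extend F) (⊆-antisym F⊆G G⊆F) λ _ → id)
    tower-compare {G = G} (union C t) q with em {P = ∃[ F ] T (C F) × ¬ F ⊆ G}
    ... | no ∄ = inj₁ λ y y∈⋃ → let F , c , y∈F = ⟪⟫⁻ y∈⋃ in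
                 ¬¬-elim λ y∉G → ∄ (F , c , λ F⊆G → y∉G (F⊆G y y∈F))
    ... | yes (F , c , F⊈G) with tower-compare (t c) q
    ...   | inj₁ F⊆G  = contradiction F⊆G F⊈G
    ...   | inj₂ G′⊆F = inj₂ λ y y∈G′ → ⟪⟫⁺ (F , c , G′⊆F y y∈G′)

    tower-chain : ∀ {F G} → Tower F → Tower G → F ⊆ G ⊎ G ⊆ F
    tower-chain {G = G} p q with tower-compare p q
    ... | inj₁ F⊆G  = inj₁ F⊆G
    ... | inj₂ G′⊆F = inj₂ λ y → G′⊆F y ∘ extend-inflationary G y

    -- In a chain, the largest of finitely many witnessing members contains the whole list. The list
    -- is nonempty because `C` may be empty.
    finite-union : ∀ C → (∀ {F} → T (C F) → Tower F) → ∀ {y ys} →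
                   All (T ∘ ⋃ C) (y ∷ ys) → ∃[ F ] T (C F) × All (T ∘ F) (y ∷ ys)
    finite-union C t (p ∷ []) with ⟪⟫⁻ p
    ... | F , c , y∈F = F , c , y∈F ∷ []
    finite-union C t (p ∷ ps@(_ ∷ _)) with ⟪⟫⁻ p | finite-union C t ps
    ... | F , c , y∈F | G , d , ys∈G with tower-chain (t c) (t d)
    ...   | inj₁ F⊆G = G , d , F⊆G _ y∈F ∷ ys∈G
    ...   | inj₂ G⊆F = F , c , y∈F ∷ All.map (G⊆F _) ys∈G

    tower-consistent : ∀ {F} → Tower F → Consistent F
    tower-consistent (step {F} p) = extend-consistent F (tower-consistent p)
    tower-consistent (union C t) [] = OK-[]
    tower-consistent (union C t) ps@(_ ∷ _) with finite-union C t ps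
    ... | F , c , ys∈F = tower-consistent (t c) ys∈F

    top : Subset
    top = ⋃ λ F → ⟪ Tower F ⟫

    top-tower : Tower top
    top-tower = union _ ⟪⟫⁻

    top-consistent : Consistent top
    top-consistent = tower-consistent top-tower

    -- `top` is itself a tower set, so `extend top` is one of the sets united in `top`, and nothing
    -- consistent is left to adjoin.
    top-maximal : ∀ {y} → Consistent (insert y top) → T (top y)
    top-maximal {y} con = ¬¬-elim λ y∉top →
      extend-closed top (λ _ z∈ → ⟪⟫⁺ (extend top , ⟪⟫⁺ (step top-tower) , z∈))
        (y , y∉top , con)

    -- `zs` collects the entries taken from `F`; the others equal `y`. The last component
    -- reassembles a property of `ys` from `y` and `zs`.
    split-insert : ∀ {F y ys} → All (T ∘ insert y F) ys →
                   ∃[ zs ] All (T ∘ F) zs × (∀ {Q : Y → Set} → Q y → All Q zs → All Q ys)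
    split-insert [] = [] , [] , λ _ _ → []
    split-insert (p ∷ ps) with ⟪⟫⁻ p | split-insert ps
    ... | inj₁ z∈F  | zs , zs∈F , f = _ ∷ zs , z∈F ∷ zs∈F , λ { q (r ∷ rs) → r ∷ f q rs }
    ... | inj₂ refl | zs , zs∈F , f = zs , zs∈F , λ q rs → q ∷ f q rs

  -- Ultrafilters and ultraproducts

  record Ultrafilter (I : Set) : Set₁ where
    field
      Large : Pred (Pred I 0ℓ) 0ℓ
      mono  : ∀ {P Q : Pred I 0ℓ} → (∀ i → P i → Q i) → Large P → Large Q
      inter : ∀ {P Q} → Large P → Large Q → Large (λ i → P i × Q i)
      proper : ¬ Large (λ _ → ⊥)
      ultra : ∀ P → Large P ⊎ Large (∁ P)

    always : ∀ {P} → (∀ i → P i) → Large P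
    always {P} all with ultra P
    ... | inj₁ l = l
    ... | inj₂ l = ⊥-elim (proper (mono (λ i ¬p → ¬p (all i)) l))

    mono₂ : ∀ {P Q R : Pred I 0ℓ} → (∀ i → P i → Q i → R i) → Large P → Large Q → Large R
    mono₂ f p q = mono (λ i (x , y) → f i x y) (inter p q)

  module _ {I : Set} (_≤_ : I → I → Set)
    (≤-refl : ∀ {i} → i ≤ i) (≤-trans : ∀ {i j k} → i ≤ j → j ≤ k → i ≤ k)
    (directed : ∀ i j → ∃[ k ] i ≤ k × j ≤ k) (i₀ : I) where

    private
      -- Finite intersections must be cofinal, not merely nonempty; this forces all tails into a
      -- maximal family.
      Cofinal : List (I → Bool) → Set
      Cofinal Ss = ∀ i → ∃[ j ] i ≤ j × All (λ S → T (S j)) Ss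

      open Maximal Cofinal (λ i → i , ≤-refl , [])

      -- By directedness, the members `Ss` and any further ones meet above both `i` and any given
      -- `j`, and there `P` holds; so adjoining `P` is consistent.
      closed : ∀ (P : Pred I 0ℓ) i Ss → All (T ∘ top) Ss →
               (∀ j → i ≤ j → All (λ S → T (S j)) Ss → P j) → T (top (λ j → ⟪ P j ⟫))
      closed P i Ss Ss∈ h = top-maximal λ {Rs} Rs∈ j →
        let Qs , Qs∈ , merge = split-insert Rs∈
            k , i≤k , j≤k    = directed i j
            l , k≤l , all    = top-consistent (++⁺ Ss∈ Qs∈) k
            p                = h l (≤-trans i≤k k≤l) (All.++⁻ˡ Ss all)
        in l , ≤-trans j≤k k≤l , merge (⟪⟫⁺ p) (All.++⁻ʳ Ss all)

    tail-ultrafilter : Σ[ 𝒰 ∈ Ultrafilter I ] ∀ i → Ultrafilter.Large 𝒰 (i ≤_)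
    tail-ultrafilter = record
      { Large  = λ P → T (top (λ i → ⟪ P i ⟫))
      ; mono   = λ {P} {Q} P⊆Q p →
                 closed Q i₀ _ (p ∷ []) λ { j _ (x ∷ []) → P⊆Q j (⟪⟫⁻ x) }
      ; inter  = λ {P} {Q} p q →
                 closed _ i₀ _ (p ∷ q ∷ []) λ { j _ (x ∷ y ∷ []) → ⟪⟫⁻ x , ⟪⟫⁻ y }
      ; proper = λ p → no-⊥-tail (top-consistent (p ∷ []) i₀)
      ; ultra  = decide
      } , λ i → closed (i ≤_) i [] [] λ j i≤j _ → i≤j
      where
      no-⊥-tail : ∃[ j ] i₀ ≤ j × All (λ S → T (S j)) ((λ _ → ⟪ ⊥ ⟫) ∷ []) → ⊥
      no-⊥-tail (_ , _ , x ∷ []) = ⟪⟫⁻ x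

      -- If `P` cannot be adjoined, some finite intersection `Qs` of members is disjoint from `P`
      -- above some `i`, so `closed` puts the complement in.
      decide : ∀ P → T (top (λ i → ⟪ P i ⟫)) ⊎ T (top (λ i → ⟪ ∁ P i ⟫))
      decide P with em {P = T (top (λ i → ⟪ P i ⟫))}
      ... | yes p = inj₁ p
      ... | no ¬p with ¬∀⇒∃¬ {P = λ Ss → All (T ∘ insert (λ i → ⟪ P i ⟫) top) Ss → Cofinal Ss}
                         (λ con → ¬p (top-maximal λ {Ss} → con Ss))
      ...   | Ss , ¬con =
        let Ss∈ = ¬¬-elim λ Ss∉ → ¬con λ Ss∈ → ⊥-elim (Ss∉ Ss∈)
            i , ¬above = ¬∀⇒∃¬ (λ cof → ¬con λ _ → cof)
            Qs , Qs∈ , merge = split-insert Ss∈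
        in inj₂ (closed (∁ P) i Qs Qs∈ λ j i≤j all Pj →
             ¬above (j , i≤j , merge (⟪⟫⁺ Pj) all))

  -- Quotients by canonical representatives.

  module Quotient {P : Set} (_~_ : P → P → Set)
    (~-refl : ∀ {x} → x ~ x) (~-sym : ∀ {x y} → x ~ y → y ~ x)
    (~-trans : ∀ {x y z} → x ~ y → y ~ z → x ~ z) where

    private
      -- The default `d` only makes the function total: on a nonempty class the result depends on
      -- the class alone.
      pick : (P → Bool) → P → P
      pick f d with em {P = ∃[ y ] T (f y)}
      ... | yes (y , _) = y
      ... | no _        = d

      pick-∈ : ∀ (f : P → Bool) d → ∃[ y ] T (f y) → T (f (pick f d))
      pick-∈ f d ∃y with em {P = ∃[ y ] T (f y)}
      ... | yes (_ , p) = p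
      ... | no ∄y       = contradiction ∃y ∄y

      pick-irrelevant : ∀ (f : P → Bool) d d′ → ∃[ y ] T (f y) → pick f d ≡ pick f d′
      pick-irrelevant f d d′ ∃y with em {P = ∃[ y ] T (f y)}
      ... | yes _ = refl
      ... | no ∄y = contradiction ∃y ∄y

      class : P → P → Bool
      class x y = ⟪ x ~ y ⟫

      canon : P → P
      canon x = pick (class x) x

      canon-~ : ∀ x → x ~ canon x
      canon-~ x = ⟪⟫⁻ (pick-∈ (class x) x (x , ⟪⟫⁺ ~-refl))

      -- Boolean-valued classes are equal by function extensionality alone.
      canon-cong : ∀ {x y} → x ~ y → canon x ≡ canon y
      canon-cong {x} {y} x~y = trans (pick-irrelevant (class x) x y (x , ⟪⟫⁺ ~-refl))
        (cong (λ f → pick f y) (funext λ z → T-ext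
          (λ p → ⟪⟫⁺ (~-trans (~-sym x~y) (⟪⟫⁻ p))) (λ p → ⟪⟫⁺ (~-trans x~y (⟪⟫⁻ p)))))

    Q : Set
    Q = Σ[ x ∈ P ] canon x ≡ x

    rep : Q → P
    rep = proj₁

    [_]~ : P → Q
    [ x ]~ = canon x , canon-cong (~-sym (canon-~ x))

    rep-[] : ∀ x → rep [ x ]~ ~ x
    rep-[] x = ~-sym (canon-~ x)

    effective : ∀ {q r} → rep q ~ rep r → q ≡ r
    effective {x , p} {y , q} x~y with trans (sym p) (trans (canon-cong x~y) q)
    ... | refl = cong (x ,_) (uip p q)

  -- Ultraproducts and the theorem of Łoś.

  module Ultraproduct {S : Signature} {I : Set} (𝒰 : Ultrafilter I)
    (N : I → Structure S) (point : ∀ i → ∣ N i ∣) where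
    open Ultrafilter 𝒰

    open Quotient {P = ∀ i → ∣ N i ∣} (λ x y → Large (λ i → x i ≡ y i))
      (always λ _ → refl) (mono λ _ → sym) (mono₂ λ _ → trans)
      using (Q; rep; rep-[]; effective) renaming ([_]~ to [_]) public

    at : ∀ i → Q → ∣ N i ∣
    at i q = rep q i

    ∏ : Structure S
    ∏ = record
      { Carrier = Q
      ; fun     = λ f qs → [ (λ i → Structure.fun (N i) f (map (at i) qs)) ]
      ; rel     = λ R qs → Large (λ i → map (at i) qs ∈ Structure.rel (N i) R)
      }

    mutual
      at-eval : ∀ {n} (ρ : Vec Q n) t →
                Large (λ i → at i (eval ∏ ρ t) ≡ eval (N i) (map (at i) ρ) t)
      at-eval ρ (var v)    = always λ i → sym (lookup-map v (at i) ρ)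
      at-eval ρ (app f ts) =
        mono₂ (λ i e e′ → trans e (cong (Structure.fun (N i) f) e′)) (rep-[] _) (at-evals ρ ts)

      at-evals : ∀ {n k} (ρ : Vec Q n) (ts : Vec (Term S n) k) →
                 Large (λ i → map (at i) (evals ∏ ρ ts) ≡ evals (N i) (map (at i) ρ) ts)
      at-evals ρ []       = always λ _ → refl
      at-evals ρ (t ∷ ts) = mono₂ (λ _ → cong₂ _∷_) (at-eval ρ t) (at-evals ρ ts)

    mutual
      -- The two directions are mutually recursive because implication is contravariant in its
      -- premise.
      łoś⁺ : ∀ {n} (φ : Formula S n) (ρ : Vec Q n) → Satisfies ∏ ρ φ →
             Large (λ i → Satisfies (N i) (map (at i) ρ) φ)
      łoś⁺ (s `≡ t) ρ s≡t =
        mono₂ (λ i p q → trans (sym p) (trans (cong (at i) s≡t) q)) (at-eval ρ s) (at-eval ρ t)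
      łoś⁺ (atom R ts) ρ r =
        mono₂ (λ i → subst (Structure.rel (N i) R)) (at-evals ρ ts) r
      łoś⁺ (φ `⇒ ψ) ρ h with ultra (λ i → Satisfies (N i) (map (at i) ρ) φ)
      ... | inj₁ p  = mono (λ _ q _ → q) (łoś⁺ ψ ρ (h (łoś⁻ φ ρ p)))
      ... | inj₂ ¬p = mono (λ _ np p → contradiction p np) ¬p
      łoś⁺ (`∀ φ) ρ h with ultra (λ i → Satisfies (N i) (map (at i) ρ) (`∀ φ))
      ... | inj₁ p  = p
      -- Were the universal formula false on a large set, coordinatewise counterexamples would form
      -- a point `x` of the product, against `h [ x ]`. Where no counterexample exists, `x` takes
      -- the default `point i`.
      ... | inj₂ ¬p = ⊥-elim (proper
              (mono₂ (λ i np (e , q) →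
                 refutes i np (subst (λ x → Satisfies (N i) (x ∷ map (at i) ρ) φ) e q))
                ¬p (inter (rep-[] x) (łoś⁺ φ ([ x ] ∷ ρ) (h [ x ])))))
        where
        Bad : ∀ i → Pred ∣ N i ∣ 0ℓ
        Bad i x = ¬ Satisfies (N i) (x ∷ map (at i) ρ) φ

        x : ∀ i → ∣ N i ∣
        x i with em {P = ∃ (Bad i)}
        ... | yes (y , _) = y
        ... | no _        = point i

        refutes : ∀ i → ¬ Satisfies (N i) (map (at i) ρ) (`∀ φ) → Bad i (x i)
        refutes i ¬∀ with em {P = ∃ (Bad i)}
        ... | yes (_ , b) = b
        ... | no ∄b       = contradiction (¬∀⇒∃¬ ¬∀) ∄b

      łoś⁻ : ∀ {n} (φ : Formula S n) (ρ : Vec Q n) →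
             Large (λ i → Satisfies (N i) (map (at i) ρ) φ) → Satisfies ∏ ρ φ
      łoś⁻ `⊥ ρ l = proper l
      łoś⁻ (s `≡ t) ρ l = effective
        (mono₂ (λ i p (q , e) → trans p (trans e (sym q))) (at-eval ρ s) (inter (at-eval ρ t) l))
      łoś⁻ (atom R ts) ρ l =
        mono₂ (λ i e → subst (Structure.rel (N i) R) (sym e)) (at-evals ρ ts) l
      łoś⁻ (φ `⇒ ψ) ρ l p = łoś⁻ ψ ρ (mono₂ (λ _ → _$_) l (łoś⁺ φ ρ p))
      łoś⁻ (`∀ φ) ρ l q = łoś⁻ φ (q ∷ ρ) (mono (λ i h → h (at i q)) l)

    ∏⊨ : ∀ {T : Theory S} → (∀ i → N i ⊨ T) → ∏ ⊨ T
    ∏⊨ all φ φ∈T = łoś⁻ φ [] (always λ i → all i φ φ∈T)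

  -- Embeddings

  -- With the map as a parameter, embeddings can be transported along equalities of maps, and
  -- embeddings of two reducts can share one map.
  record IsEmbedding {S : Signature} (M N : Structure S) (h : ∣ M ∣ → ∣ N ∣) : Set where
    field
      injective : Injective _≡_ _≡_ h
      fun-homo  : ∀ {k} (f : Fun S k) xs →
                  h (Structure.fun M f xs) ≡ Structure.fun N f (map h xs)
      rel-homo  : ∀ {k} (R : Rel S k) xs →
                  (xs ∈ Structure.rel M R) ⇔ (map h xs ∈ Structure.rel N R)

  open IsEmbedding

  isEmbedding : ∀ {S} {M N : Structure S} (μ : Embedding M N) → IsEmbedding M N (Embedding.to μ)
  isEmbedding μ = record
    { injective = Embedding.injective μ
    ; fun-homo  = Embedding.fun-homo μ
    ; rel-homo  = Embedding.rel-homo μ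
    }

  module _ {S : Signature} {M N P : Structure S} {g : ∣ N ∣ → ∣ P ∣} {h : ∣ M ∣ → ∣ N ∣} where

    ∘-isEmbedding : IsEmbedding N P g → IsEmbedding M N h → IsEmbedding M P (g ∘ h)
    ∘-isEmbedding G H = record
      { injective = injective H ∘ injective G
      ; fun-homo  = λ f xs → trans (cong g (fun-homo H f xs)) (trans (fun-homo G f (map h xs))
                      (cong (Structure.fun P f) (sym (map-∘ g h xs))))
      ; rel-homo  = λ R xs → mk⇔
          (λ r → subst (Structure.rel P R) (sym (map-∘ g h xs))
            (to (rel-homo G R (map h xs)) (to (rel-homo H R xs) r)))
          (λ r → from (rel-homo H R xs) (from (rel-homo G R (map h xs))
            (subst (Structure.rel P R) (map-∘ g h xs) r)))
      }
      where open Equivalence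

    ∘-cancel-isEmbedding : IsEmbedding N P g → IsEmbedding M P (g ∘ h) → IsEmbedding M N h
    ∘-cancel-isEmbedding G GH = record
      { injective = injective GH ∘ cong g
      ; fun-homo  = λ f xs → injective G (trans (fun-homo GH f xs)
                      (trans (cong (Structure.fun P f) (map-∘ g h xs))
                        (sym (fun-homo G f (map h xs)))))
      ; rel-homo  = λ R xs → mk⇔
          (λ r → from (rel-homo G R (map h xs))
            (subst (Structure.rel P R) (map-∘ g h xs) (to (rel-homo GH R xs) r)))
          (λ r → from (rel-homo GH R xs)
            (subst (Structure.rel P R) (sym (map-∘ g h xs)) (to (rel-homo G R (map h xs)) r)))
      }
      where open Equivalence

  -- Infinite extensions with prescribed new elements

  -- If `xs` exhausted `A`, removing duplicates would give an enumeration without repetition, hence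
  -- a bijection with some `Fin n`.
  infinite⇒fresh : ∀ {A : Set} → Infinite A → (xs : List A) → ∃[ a ] ¬ a ∈ˡ xs
  infinite⇒fresh {A} inf xs = ¬¬-elim λ ∄fresh → let all∈ = λ a a∉ → ∄fresh (a , a∉) in
    inf (List.length ys , mk↔ₛ′
      (λ a → Any.index (∈ys all∈ a)) (List.lookup ys)
      (λ i → lookup-injective ys-unique (sym (Any.lookup-index (∈ys all∈ (List.lookup ys i)))))
      (λ a → sym (Any.lookup-index (∈ys all∈ a))))
    where
    ys : List A
    ys = List.deduplicate (λ _ _ → em) xs

    ys-unique : Unique ys
    ys-unique = deduplicate-! (λ _ _ → em) xs

    ∈ys : (∀ a → ¬ ¬ a ∈ˡ xs) → ∀ a → a ∈ˡ ys
    ∈ys all∈ a = ∈-deduplicate⁺ (λ _ _ → em) (¬¬-elim (all∈ a))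

    lookup-injective : ∀ {zs : List A} → Unique zs →
                       ∀ {i j} → List.lookup zs i ≡ List.lookup zs j → i ≡ j
    lookup-injective (z∉ ∷ uniq) {zero}  {zero}  _ = refl
    lookup-injective (z∉ ∷ uniq) {zero}  {suc j} e = contradiction e (All.lookup z∉ (∈-lookup j))
    lookup-injective (z∉ ∷ uniq) {suc i} {zero}  e = contradiction (sym e) (All.lookup z∉ (∈-lookup i))
    lookup-injective (z∉ ∷ uniq) {suc i} {suc j} e = cong suc (lookup-injective uniq e)

  fresh-map : ∀ {A X : Set} → Infinite A → (as : List A) (xs : List X) →
              Σ[ e ∈ (X → A) ] (∀ {x} → x ∈ˡ xs → ¬ e x ∈ˡ as) ×
                (∀ {x y} → x ∈ˡ xs → y ∈ˡ xs → e x ≡ e y → x ≡ y)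
  fresh-map inf as [] = (λ _ → proj₁ (infinite⇒fresh inf [])) , (λ ()) , λ ()
  fresh-map {A} {X} inf as (x ∷ xs) with fresh-map inf as xs | em {P = x ∈ˡ xs}
  ... | e , avoid , inj | yes x∈xs = e , avoid ∘ old , λ p q → inj (old p) (old q)
    where
    old : ∀ {y} → y ∈ˡ x ∷ xs → y ∈ˡ xs
    old (here refl) = x∈xs
    old (there p)   = p
  ... | e , avoid , inj | no x∉xs = e′ , avoid′ , inj′
    where
    new : ∃[ a ] ¬ a ∈ˡ (as ++ List.map e xs)
    new = infinite⇒fresh inf (as ++ List.map e xs)

    e′ : X → A
    e′ y with em {P = y ≡ x}
    ... | yes _ = proj₁ new
    ... | no _  = e y

    e′-new : e′ x ≡ proj₁ new
    e′-new with em {P = x ≡ x}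
    ... | yes _  = refl
    ... | no x≢x = contradiction refl x≢x

    e′-old : ∀ {y} → y ∈ˡ xs → e′ y ≡ e y
    e′-old {y} y∈xs with em {P = y ≡ x}
    ... | yes refl = contradiction y∈xs x∉xs
    ... | no _     = refl

    new≢old : ∀ {y} → y ∈ˡ xs → e′ x ≢ e′ y
    new≢old y∈xs eq = proj₂ new (∈-++⁺ʳ as (subst (_∈ˡ List.map e xs)
      (trans (sym (e′-old y∈xs)) (trans (sym eq) e′-new)) (∈-map⁺ e y∈xs)))

    avoid′ : ∀ {y} → y ∈ˡ x ∷ xs → ¬ e′ y ∈ˡ as
    avoid′ (here refl) p = proj₂ new (∈-++⁺ˡ (subst (_∈ˡ as) e′-new p))
    avoid′ (there y∈xs) p = avoid y∈xs (subst (_∈ˡ as) (e′-old y∈xs) p)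

    inj′ : ∀ {y z} → y ∈ˡ x ∷ xs → z ∈ˡ x ∷ xs → e′ y ≡ e′ z → y ≡ z
    inj′ (here refl) (here refl) _  = refl
    inj′ (here refl) (there q)   eq = contradiction eq (new≢old q)
    inj′ (there p)   (here refl) eq = contradiction (sym eq) (new≢old p)
    inj′ (there p)   (there q)   eq = inj p q (trans (sym (e′-old p)) (trans eq (e′-old q)))

  variables : ∀ {A : Set} (as : List A) →
              ∃[ n ] Σ[ ρ ∈ Vec A n ] Σ[ idx ∈ (A → Fin n) ] (∀ {a} → a ∈ˡ as → lookup ρ (idx a) ≡ a)
  variables {A} as with em {P = A}
  ... | no ¬A = 0 , [] , ⊥-elim ∘ ¬A , λ {a} _ → contradiction a ¬A
  ... | yes a₀ = go as
    where
    go : (as : List A) →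
         ∃[ n ] Σ[ ρ ∈ Vec A n ] Σ[ idx ∈ (A → Fin n) ] (∀ {a} → a ∈ˡ as → lookup ρ (idx a) ≡ a)
    -- The variable for `a₀` is always present, so that `idx` can be total; outside the list its
    -- values are arbitrary.
    go [] = 1 , a₀ ∷ [] , (λ _ → zero) , λ ()
    go (b ∷ as) with go as
    ... | n , ρ , idx , ok = suc n , b ∷ ρ , idx′ , ok′
      where
      idx′ : A → Fin (suc n)
      idx′ a with em {P = a ≡ b}
      ... | yes _ = zero
      ... | no _  = suc (idx a)

      ok′ : ∀ {a} → a ∈ˡ b ∷ as → lookup (b ∷ ρ) (idx′ a) ≡ a
      ok′ {a} a∈ with em {P = a ≡ b} | a∈
      ... | yes refl | _         = refl
      ... | no a≢b   | here a≡b  = contradiction a≡b a≢b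
      ... | no _     | there a∈′ = ok a∈′

  infix 8 `¬_
  `¬_ : ∀ {S n} → Formula S n → Formula S n
  `¬ φ = φ `⇒ `⊥

  ⋀ : ∀ {S n} → List (Formula S n) → Formula S n
  ⋀ []       = `¬ `⊥
  ⋀ (φ ∷ φs) = `¬ (φ `⇒ `¬ ⋀ φs)

  ⋀-quantifierFree : ∀ {S n} {φs : List (Formula S n)} → All QuantifierFree φs → QuantifierFree (⋀ φs)
  ⋀-quantifierFree []       = `⊥ `⇒ `⊥
  ⋀-quantifierFree (q ∷ qs) = (q `⇒ (⋀-quantifierFree qs `⇒ `⊥)) `⇒ `⊥

  ⋀⁺ : ∀ {S n} (M : Structure S) {ρ : Vec ∣ M ∣ n} {φs} → All (Satisfies M ρ) φs → Satisfies M ρ (⋀ φs)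
  ⋀⁺ M []       ()
  ⋀⁺ M (p ∷ ps) h = h p (⋀⁺ M ps)

  ⋀⁻ : ∀ {S n} (M : Structure S) {ρ : Vec ∣ M ∣ n} φs → Satisfies M ρ (⋀ φs) → All (Satisfies M ρ) φs
  ⋀⁻ M []       _ = []
  ⋀⁻ M (φ ∷ φs) h =
    ¬¬-elim (λ ¬p → h λ p → contradiction p ¬p) ∷
    ⋀⁻ M φs (¬¬-elim λ ¬ps → h λ _ ps → ¬ps ps)

  evals-var : ∀ {S n k} (M : Structure S) (ρ : Vec ∣ M ∣ n) {A : Set} (idx : A → Fin n) (xs : Vec A k) →
              evals M ρ (map (var ∘ idx) xs) ≡ map (lookup ρ ∘ idx) xs
  evals-var M ρ idx []       = refl
  evals-var M ρ idx (x ∷ xs) = cong (_ ∷_) (evals-var M ρ idx xs)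

  map-fixed : ∀ {A : Set} {k} (g : A → A) (xs : Vec A k) →
              (∀ {a} → a ∈ˡ Vec.toList xs → g a ≡ a) → map g xs ≡ xs
  map-fixed g []       _     = refl
  map-fixed g (x ∷ xs) fixed = cong₂ _∷_ (fixed (here refl)) (map-fixed g xs (fixed ∘ there))

  ∈-concatMap-⊆ : ∀ {A B : Set} (f : A → List B) {x xs} → x ∈ˡ xs → f x ⊆ˡ List.concatMap f xs
  ∈-concatMap-⊆ f x∈xs y∈fx = ∈-concatMap⁺ f (Any.map (λ { refl → y∈fx }) x∈xs)

  module Extension {S : Signature} {T : Theory S} (stable : StablyInfinite T)
    {N₀ : Structure S} (N₀⊨T : N₀ ⊨ T) (X : Set) where

    private module N₀ = Structure N₀

    -- The diagram of `N₀`, together with the demand that the points of `X` be new and distinct.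
    -- Where all constraints hold, `α` is an embedding and `e` lists distinct elements outside its
    -- image.
    data Constraint : Set where
      fun-graph : ∀ {k} → Fun S k → Vec ∣ N₀ ∣ k → Constraint
      rel-graph : ∀ {k} → Rel S k → Vec ∣ N₀ ∣ k → Constraint
      old-old   : ∣ N₀ ∣ → ∣ N₀ ∣ → Constraint
      old-new   : ∣ N₀ ∣ → X → Constraint
      new-new   : X → X → Constraint

    module _ (N : Structure S) (α : ∣ N₀ ∣ → ∣ N ∣) (e : X → ∣ N ∣) where
      Holds : Constraint → Set
      Holds (fun-graph f xs) = α (N₀.fun f xs) ≡ Structure.fun N f (map α xs)
      Holds (rel-graph R xs) = (xs ∈ N₀.rel R) ⇔ (map α xs ∈ Structure.rel N R)
      Holds (old-old a b)    = α a ≡ α b → a ≡ b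
      Holds (old-new a x)    = α a ≢ e x
      Holds (new-new x y)    = e x ≡ e y → x ≡ y

    old : Constraint → List ∣ N₀ ∣
    old (fun-graph f xs) = N₀.fun f xs ∷ Vec.toList xs
    old (rel-graph R xs) = Vec.toList xs
    old (old-old a b)    = a ∷ b ∷ []
    old (old-new a x)    = a ∷ []
    old (new-new x y)    = []

    new : Constraint → List X
    new (old-new a x) = x ∷ []
    new (new-new x y) = x ∷ y ∷ []
    new _             = []

    literal : ∀ {n} {P : Set} → Dec P → Formula S n → Formula S n
    literal (yes _) φ = φ
    literal (no _)  φ = `¬ φ

    module _ {n} (idx : ∣ N₀ ∣ → Fin n) where

      -- Only the diagram of `N₀` enters the formula. Constraints on new elements become
      -- tautologies; in an infinite model they are met afterwards by the choice of `e`.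
      ⌜_⌝ : Constraint → Formula S n
      ⌜ fun-graph f xs ⌝ = app f (map (var ∘ idx) xs) `≡ var (idx (N₀.fun f xs))
      ⌜ rel-graph R xs ⌝ = literal (em {P = xs ∈ N₀.rel R}) (atom R (map (var ∘ idx) xs))
      ⌜ old-old a b ⌝    = literal (em {P = a ≡ b}) (var (idx a) `≡ var (idx b))
      ⌜ old-new a x ⌝    = `¬ `⊥
      ⌜ new-new x y ⌝    = `¬ `⊥

      ⌜⌝-quantifierFree : ∀ c → QuantifierFree ⌜ c ⌝
      ⌜⌝-quantifierFree (fun-graph f xs) = _ `≡ _
      ⌜⌝-quantifierFree (rel-graph R xs) with em {P = xs ∈ N₀.rel R}
      ... | yes _ = atom R _
      ... | no _  = atom R _ `⇒ `⊥
      ⌜⌝-quantifierFree (old-old a b) with em {P = a ≡ b}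
      ... | yes _ = _ `≡ _
      ... | no _  = (_ `≡ _) `⇒ `⊥
      ⌜⌝-quantifierFree (old-new a x) = `⊥ `⇒ `⊥
      ⌜⌝-quantifierFree (new-new x y) = `⊥ `⇒ `⊥

      ⌜⌝-true : ∀ ρ c → (∀ {a} → a ∈ˡ old c → lookup ρ (idx a) ≡ a) → Satisfies N₀ ρ ⌜ c ⌝
      ⌜⌝-true ρ (fun-graph f xs) ok =
        trans (cong (N₀.fun f) (trans (evals-var N₀ ρ idx xs) (map-fixed _ xs (ok ∘ there))))
              (sym (ok (here refl)))
      ⌜⌝-true ρ (rel-graph R xs) ok with em {P = xs ∈ N₀.rel R}
      ... | yes r = subst (N₀.rel R) (sym (trans (evals-var N₀ ρ idx xs) (map-fixed _ xs ok))) r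
      ... | no ¬r = ¬r ∘ subst (N₀.rel R) (trans (evals-var N₀ ρ idx xs) (map-fixed _ xs ok))
      ⌜⌝-true ρ (old-old a b) ok with em {P = a ≡ b}
      ... | yes refl = refl
      ... | no a≢b   = λ eq →
        a≢b (trans (sym (ok (here refl))) (trans eq (ok (there (here refl)))))
      ⌜⌝-true ρ (old-new a x) ok = id
      ⌜⌝-true ρ (new-new x y) ok = id

      ⌜⌝-holds : ∀ {N : Structure S} {e : X → ∣ N ∣} {as xs} (ρ : Vec ∣ N ∣ n) →
                 (let α = lookup ρ ∘ idx) →
                 (∀ {x} → x ∈ˡ xs → ¬ e x ∈ˡ List.map α as) →
                 (∀ {x y} → x ∈ˡ xs → y ∈ˡ xs → e x ≡ e y → x ≡ y) →
                 ∀ c → (∀ {a} → a ∈ˡ old c → a ∈ˡ as) → (∀ {x} → x ∈ˡ new c → x ∈ˡ xs) →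
                 Satisfies N ρ ⌜ c ⌝ → Holds N α e c
      ⌜⌝-holds {N} ρ avoid inj (fun-graph f xs) _ _ s =
        trans (sym s) (cong (Structure.fun N f) (evals-var N ρ idx xs))
      ⌜⌝-holds {N} ρ avoid inj (rel-graph R xs) _ _ s with em {P = xs ∈ N₀.rel R}
      ... | yes r = mk⇔ (λ _ → subst (Structure.rel N R) (evals-var N ρ idx xs) s) (λ _ → r)
      ... | no ¬r = mk⇔ (⊥-elim ∘ ¬r)
                        (⊥-elim ∘ s ∘ subst (Structure.rel N R) (sym (evals-var N ρ idx xs)))
      ⌜⌝-holds ρ avoid inj (old-old a b) _ _ s with em {P = a ≡ b}
      ... | yes a≡b = λ _ → a≡b
      ... | no _    = ⊥-elim ∘ s
      ⌜⌝-holds {as = as} ρ avoid inj (old-new a x) old⊆ new⊆ _ eq =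
        avoid (new⊆ (here refl)) (subst (_∈ˡ List.map (lookup ρ ∘ idx) as) eq
          (∈-map⁺ _ (old⊆ (here refl))))
      ⌜⌝-holds ρ avoid inj (new-new x y) _ new⊆ _ =
        inj (new⊆ (here refl)) (new⊆ (there (here refl)))

    record Realisation (cs : List Constraint) : Set₁ where
      field
        N     : Structure S
        N⊨T   : N ⊨ T
        α     : ∣ N₀ ∣ → ∣ N ∣
        e     : X → ∣ N ∣
        point : ∣ N ∣
        holds : ∀ {c} → c ∈ˡ cs → Holds N α e c

    -- `N₀` satisfies the conjunction under `ρ₀`, so stable infiniteness yields an infinite model.
    -- Its assignment determines `α`, and `fresh-map` places the new elements outside the relevant
    -- values of `α`.
    realise : ∀ cs → Realisation cs
    realise cs with variables (List.concatMap old cs)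
    ... | n , ρ₀ , idx , ok
      with stable (⋀ (List.map (⌜_⌝ idx) cs))
             (⋀-quantifierFree (All.map⁺ (All.universal (⌜⌝-quantifierFree idx) cs)))
             (N₀ , N₀⊨T , ρ₀ , ⋀⁺ N₀ (All.map⁺ (All.tabulate {xs = cs} λ {c} c∈cs →
               ⌜⌝-true idx ρ₀ c (ok ∘ ∈-concatMap-⊆ old c∈cs))))
    ...   | N , N⊨T , inf , ρ , sat
      with fresh-map inf (List.map (lookup ρ ∘ idx) (List.concatMap old cs)) (List.concatMap new cs)
    ...     | e , avoid , inj = record
      { N     = N
      ; N⊨T   = N⊨T
      ; α     = lookup ρ ∘ idx
      ; e     = e
      ; point = proj₁ (infinite⇒fresh inf [])
      ; holds = λ {c} c∈cs → ⌜⌝-holds idx ρ avoid inj c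
          (∈-concatMap-⊆ old c∈cs) (∈-concatMap-⊆ new c∈cs)
          (All.lookup (All.map⁻ (⋀⁻ N _ sat)) c∈cs)
      }

    private
      I : Set
      I = List Constraint

      -- Abstract, since unfolding the ultrafilter or the realisations during
      -- unification makes type checking prohibitively slow.
      abstract
        tails : Σ[ 𝒰 ∈ Ultrafilter I ] ∀ cs → Ultrafilter.Large 𝒰 (cs ⊆ˡ_)
        tails = tail-ultrafilter _⊆ˡ_ id (λ p q → q ∘ p)
          (λ cs ds → cs ++ ds , ∈-++⁺ˡ , ∈-++⁺ʳ cs) []

        realisation : ∀ cs → Realisation cs
        realisation = realise

      module R cs = Realisation (realisation cs)

    open Ultrafilter (proj₁ tails)
    open Ultraproduct (proj₁ tails) R.N R.point

    extension : Structure S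
    extension = ∏

    extension⊨ : extension ⊨ T
    extension⊨ = ∏⊨ R.N⊨T

    inclusion : ∣ N₀ ∣ → ∣ extension ∣
    inclusion a = [ (λ i → R.α i a) ]

    fresh : X → ∣ extension ∣
    fresh x = [ (λ i → R.e i x) ]

    private
      -- The lists containing `c` form the tail above `c ∷ []`, which is large.
      eventually : ∀ c → Large (λ i → Holds (R.N i) (R.α i) (R.e i) c)
      eventually c = mono (λ i c∈i → R.holds i (c∈i (here refl))) (proj₂ tails (c ∷ []))

      at-inclusion : ∀ {k} (xs : Vec ∣ N₀ ∣ k) →
                     Large (λ i → map (at i) (map inclusion xs) ≡ map (R.α i) xs)
      at-inclusion []       = always λ _ → refl
      at-inclusion (x ∷ xs) = mono₂ (λ _ → cong₂ _∷_) (rep-[] _) (at-inclusion xs)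

      ~-of-≡ : ∀ {x y} → [ x ] ≡ [ y ] → Large (λ i → x i ≡ y i)
      ~-of-≡ {x} {y} eq = mono₂ (λ i p q → trans (sym p) (trans (cong (at i) eq) q))
                                (rep-[] x) (rep-[] y)

      ≡-of-~ : ∀ {x y} → Large (λ i → x i ≡ y i) → [ x ] ≡ [ y ]
      ≡-of-~ {x} {y} l = effective
        (mono₂ (λ i p (q , e) → trans p (trans e (sym q))) (rep-[] x) (inter (rep-[] y) l))

      extract : ∀ {P : Set} → Large (λ _ → P) → P
      extract {P} l = ¬¬-elim λ ¬p → proper (mono (λ _ → ¬p) l)

    inclusion-isEmbedding : IsEmbedding N₀ extension inclusion
    inclusion-isEmbedding = record
      { injective = λ {a} {b} eq → extract (mono₂ (λ _ → _$_) (eventually (old-old a b)) (~-of-≡ eq))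
      ; fun-homo  = λ f xs → ≡-of-~ (mono₂
          (λ i p q → trans p (cong (Structure.fun (R.N i) f) (sym q)))
          (eventually (fun-graph f xs)) (at-inclusion xs))
      ; rel-homo  = λ R xs → mk⇔
          (λ r → mono₂ (λ i h q → subst (Structure.rel (R.N i) R) (sym q) (Equivalence.to h r))
            (eventually (rel-graph R xs)) (at-inclusion xs))
          (λ l → extract (mono₂ (λ i (h , q) r → Equivalence.from h (subst (Structure.rel (R.N i) R) q r))
            (inter (eventually (rel-graph R xs)) (at-inclusion xs)) l))
      }

    fresh-injective : Injective _≡_ _≡_ fresh
    fresh-injective {x} {y} eq = extract (mono₂ (λ _ → _$_) (eventually (new-new x y)) (~-of-≡ eq))

    inclusion≢fresh : ∀ a x → inclusion a ≢ fresh x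
    inclusion≢fresh a x eq = extract (mono₂ (λ _ → _$_) (eventually (old-new a x)) (~-of-≡ eq))

  -- Elementary substructures

  -- The carrier is a parameter so that two signatures can be interpreted on literally the same set.
  record Interpretation (S : Signature) (C : Set) : Set₁ where
    field
      fun : ∀ {k} → Fun S k → Vec C k → C
      rel : ∀ {k} → Rel S k → Pred (Vec C k) 0ℓ

  ⟨_⟩ : ∀ {S C} → Interpretation S C → Structure S
  ⟨_⟩ {C = C} ℐ = record { Carrier = C ; Interpretation ℐ }

  -- An injection from a prescribed `W`, rather than a subset of `N`, makes `W` itself the carrier.
  -- The criterion asks for refuting elements because the universal quantifier is the primitive one.
  module TarskiVaught {S : Signature} (N : Structure S) {W : Set}
    (κ : W → ∣ N ∣) (κ-injective : Injective _≡_ _≡_ κ)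
    (closed : ∀ {k} (f : Fun S k) ws → ∃[ w ] κ w ≡ Structure.fun N f (map κ ws))
    (witness : ∀ {n} (φ : Formula S (suc n)) ws → ¬ Satisfies N (map κ ws) (`∀ φ) →
               ∃[ w ] ¬ Satisfies N (map κ (w ∷ ws)) φ)
    where

    pullback : Interpretation S W
    pullback = record
      { fun = λ f ws → proj₁ (closed f ws)
      ; rel = λ R ws → map κ ws ∈ Structure.rel N R
      }

    κ-isEmbedding : IsEmbedding ⟨ pullback ⟩ N κ
    κ-isEmbedding = record
      { injective = κ-injective
      ; fun-homo  = λ f ws → proj₂ (closed f ws)
      ; rel-homo  = λ R ws → mk⇔ id id
      }

    mutual
      κ-eval : ∀ {n} (ρ : Vec W n) t → κ (eval ⟨ pullback ⟩ ρ t) ≡ eval N (map κ ρ) t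
      κ-eval ρ (var i)    = sym (lookup-map i κ ρ)
      κ-eval ρ (app f ts) = trans (proj₂ (closed f _)) (cong (Structure.fun N f) (κ-evals ρ ts))

      κ-evals : ∀ {n k} (ρ : Vec W n) (ts : Vec (Term S n) k) →
                map κ (evals ⟨ pullback ⟩ ρ ts) ≡ evals N (map κ ρ) ts
      κ-evals ρ []       = refl
      κ-evals ρ (t ∷ ts) = cong₂ _∷_ (κ-eval ρ t) (κ-evals ρ ts)

    mutual
      elementary⁺ : ∀ {n} (φ : Formula S n) ρ → Satisfies ⟨ pullback ⟩ ρ φ → Satisfies N (map κ ρ) φ
      elementary⁺ (s `≡ t)    ρ eq = trans (sym (κ-eval ρ s)) (trans (cong κ eq) (κ-eval ρ t))
      elementary⁺ (atom R ts) ρ r  = subst (Structure.rel N R) (κ-evals ρ ts) r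
      elementary⁺ (φ `⇒ ψ)    ρ h  = elementary⁺ ψ ρ ∘ h ∘ elementary⁻ φ ρ
      elementary⁺ (`∀ φ)      ρ h  = ¬¬-elim λ ¬∀ →
        let w , ¬φ = witness φ ρ ¬∀ in ¬φ (elementary⁺ φ (w ∷ ρ) (h w))

      elementary⁻ : ∀ {n} (φ : Formula S n) ρ → Satisfies N (map κ ρ) φ → Satisfies ⟨ pullback ⟩ ρ φ
      elementary⁻ (s `≡ t)    ρ eq = κ-injective (trans (κ-eval ρ s) (trans eq (sym (κ-eval ρ t))))
      elementary⁻ (atom R ts) ρ r  = subst (Structure.rel N R) (sym (κ-evals ρ ts)) r
      elementary⁻ (φ `⇒ ψ)    ρ h  = elementary⁻ ψ ρ ∘ h ∘ elementary⁺ φ ρ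
      elementary⁻ (`∀ φ)      ρ h  = λ w → elementary⁻ φ (w ∷ ρ) (h (κ w))

  -- The bijection agrees everywhere with f or with the inverse of g, so it is
  -- prescribed wherever these two coincide.
  module CantorBernstein {A B : Set} (f : A → B) (g : B → A)
    (f-injective : Injective _≡_ _≡_ f) (g-injective : Injective _≡_ _≡_ g) where

    -- Elements whose chain of preimages under `g` and `f` ends in `A`, outside the image of `g`.
    data Orphan : A → Set where
      root  : ∀ {a} → ¬ Image g a → Orphan a
      child : ∀ {a} → Orphan a → Orphan (g (f a))

    parent : ∀ {a} → ¬ Orphan a → Image g a
    parent ¬o = ¬¬-elim (¬o ∘ root)

    bijection : A → B
    bijection a with em {P = Orphan a}
    ... | yes _ = f a
    ... | no ¬o = proj₁ (parent ¬o)

    bijection-cases : ∀ a → (Orphan a × bijection a ≡ f a) ⊎ (¬ Orphan a × g (bijection a) ≡ a)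
    bijection-cases a with em {P = Orphan a}
    ... | yes o = inj₁ (o , refl)
    ... | no ¬o = inj₂ (¬o , proj₂ (parent ¬o))

    bijection-injective : Injective _≡_ _≡_ bijection
    bijection-injective {a} {b} eq with bijection-cases a | bijection-cases b
    ... | inj₁ (_ , p)  | inj₁ (_ , q)  = f-injective (trans (sym p) (trans eq q))
    ... | inj₂ (_ , p)  | inj₂ (_ , q)  = trans (sym p) (trans (cong g eq) q)
    ... | inj₁ (o , p)  | inj₂ (¬o , q) =
      contradiction (subst Orphan (trans (cong g (trans (sym p) eq)) q) (child o)) ¬o
    ... | inj₂ (¬o , p) | inj₁ (o , q)  =
      contradiction (subst Orphan (trans (cong g (trans (sym q) (sym eq))) p) (child o)) ¬o

    -- The equation frees the index: `g b` cannot be unified with the index `g (f a)` of `child`.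
    orphan-parent : ∀ {a b} → Orphan a → a ≡ g b → ∃[ a′ ] Orphan a′ × f a′ ≡ b
    orphan-parent {b = b} (root ∉im) eq = contradiction (b , sym eq) ∉im
    orphan-parent (child {a′} o)     eq = a′ , o , g-injective eq

    bijection-surjective : ∀ b → Image bijection b
    bijection-surjective b with bijection-cases (g b)
    ... | inj₂ (_ , p) = g b , g-injective p
    ... | inj₁ (o , _) with orphan-parent o refl
    ...   | a , o′ , fa≡b with bijection-cases a
    ...     | inj₁ (_ , p)  = a , trans p fa≡b
    ...     | inj₂ (¬o , _) = contradiction o′ ¬o

  -- Skolem hulls

  -- `refuting φ` acts as a Skolem function symbol: it yields a counterexample to `φ` in its first
  -- variable whenever one exists for the given parameters.
  data Label (S : Signature) (U : Set) : Set where
    point    : U → Label S U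
    symbol   : ∀ {k} → Fun S k → Label S U
    refuting : ∀ {n} → Formula S (suc n) → Label S U

  -- The number of children is not tied to the label, since the same trees are read in two
  -- signatures.
  data Tree (L : Set) : Set where
    node : L → List (Tree L) → Tree L

  -- Missing arguments are filled with d, surplus ones are dropped.
  pad : ∀ {A : Set} → A → ∀ n → List A → Vec A n
  pad d zero    _        = []
  pad d (suc n) []       = d ∷ pad d n []
  pad d (suc n) (x ∷ xs) = x ∷ pad d n xs

  pad-toList : ∀ {A : Set} (d : A) {n} (xs : Vec A n) → pad d n (Vec.toList xs) ≡ xs
  pad-toList d []       = refl
  pad-toList d (x ∷ xs) = cong (x ∷_) (pad-toList d xs)

  -- Trees name the elements of the hull; the same trees serve as the new
  -- elements, so that the hull contains a copy of Tree L and embeds in Tree L.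
  module Hull {S : Signature} (N : Structure S) {U L : Set}
    (label : Label S U → L) (read : L → Maybe (Label S U)) (read-label : ∀ l → read (label l) ≡ just l)
    (new : L) (read-new : read new ≡ nothing)
    (p : U → ∣ N ∣) (p-injective : Injective _≡_ _≡_ p)
    (e : Tree L → ∣ N ∣) (e-injective : Injective _≡_ _≡_ e)
    (p≢e : ∀ a t → p a ≢ e t)
    where

    Refutes : ∀ {n} → Formula S (suc n) → Vec ∣ N ∣ n → Pred ∣ N ∣ 0ℓ
    Refutes φ ρ y = ¬ Satisfies N (y ∷ ρ) φ

    refuter : ∀ {n} → ∣ N ∣ → Formula S (suc n) → Vec ∣ N ∣ n → ∣ N ∣
    refuter d φ ρ with em {P = ∃ (Refutes φ ρ)}
    ... | yes (y , _) = y
    ... | no _        = d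

    refuter-refutes : ∀ {n} d (φ : Formula S (suc n)) ρ → ¬ Satisfies N ρ (`∀ φ) →
                      Refutes φ ρ (refuter d φ ρ)
    refuter-refutes d φ ρ ¬∀ with em {P = ∃ (Refutes φ ρ)}
    ... | yes (_ , r) = r
    ... | no ∄        = contradiction (¬∀⇒∃¬ ¬∀) ∄

    -- An unreadable label yields the default `d`, which `⟦_⟧` sets to the fresh element indexed by
    -- the tree itself.
    value : ∣ N ∣ → Maybe (Label S U) → List ∣ N ∣ → ∣ N ∣
    value d nothing             _  = d
    value d (just (point a))    _  = p a
    value d (just (symbol f))   ys = Structure.fun N f (pad d _ ys)
    value d (just (refuting φ)) ys = refuter d φ (pad d _ ys)

    mutual
      ⟦_⟧ : Tree L → ∣ N ∣
      ⟦ node l ts ⟧ = value (e (node l ts)) (read l) ⟦ ts ⟧*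

      ⟦_⟧* : List (Tree L) → List ∣ N ∣
      ⟦ [] ⟧*     = []
      ⟦ t ∷ ts ⟧* = ⟦ t ⟧ ∷ ⟦ ts ⟧*

    ⟦toList⟧ : ∀ {n} (ts : Vec (Tree L) n) → ⟦ Vec.toList ts ⟧* ≡ Vec.toList (map ⟦_⟧ ts)
    ⟦toList⟧ []       = refl
    ⟦toList⟧ (t ∷ ts) = cong (⟦ t ⟧ ∷_) (⟦toList⟧ ts)

    pad-⟦⟧ : ∀ d {n} (ts : Vec (Tree L) n) → pad d n ⟦ Vec.toList ts ⟧* ≡ map ⟦_⟧ ts
    pad-⟦⟧ d ts = trans (cong (pad d _) (⟦toList⟧ ts)) (pad-toList d (map ⟦_⟧ ts))

    hull-value : ∀ l ts → ∃[ d ] ⟦ node (label l) ts ⟧ ≡ value d (just l) ⟦ ts ⟧*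
    hull-value l ts = _ , cong (λ l′ → value (e (node (label l) ts)) l′ ⟦ ts ⟧*) (read-label l)

    hull-point : ∀ a → Image ⟦_⟧ (p a)
    hull-point a = node (label (point a)) [] , proj₂ (hull-value (point a) [])

    -- Through `t ↦ node new (t ∷ [])` the hull thus contains a copy of all of `Tree L`, disjoint
    -- from the image of `p`.
    hull-new : ∀ t → ⟦ node new (t ∷ []) ⟧ ≡ e (node new (t ∷ []))
    hull-new t = cong (λ l → value (e (node new (t ∷ []))) l (⟦ t ⟧ ∷ [])) read-new

    hull-fun : ∀ {k} (f : Fun S k) ts → Image ⟦_⟧ (Structure.fun N f (map ⟦_⟧ ts))
    hull-fun f ts = let d , eq = hull-value (symbol f) (Vec.toList ts) in
      _ , trans eq (cong (Structure.fun N f) (pad-⟦⟧ d ts))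

    hull-refute : ∀ {n} (φ : Formula S (suc n)) ts → ¬ Satisfies N (map ⟦_⟧ ts) (`∀ φ) →
                  ∃[ y ] Image ⟦_⟧ y × Refutes φ (map ⟦_⟧ ts) y
    hull-refute φ ts ¬∀ = let d , eq = hull-value (refuting φ) (Vec.toList ts) in
      _ , (_ , trans eq (cong (refuter d φ) (pad-⟦⟧ d ts))) , refuter-refutes d φ (map ⟦_⟧ ts) ¬∀

    H : Set
    H = Σ[ y ∈ ∣ N ∣ ] T ⟪ Image ⟦_⟧ y ⟫

    H-≡ : {x y : H} → proj₁ x ≡ proj₁ y → x ≡ y
    H-≡ refl = cong (_ ,_) (T-irrelevant _ _)

    name : H → Tree L
    name (_ , y∈H) = proj₁ (⟪⟫⁻ y∈H)

    ⟦name⟧ : ∀ x → ⟦ name x ⟧ ≡ proj₁ x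
    ⟦name⟧ (_ , y∈H) = proj₂ (⟪⟫⁻ y∈H)

    name-injective : Injective _≡_ _≡_ name
    name-injective {x} {y} eq = H-≡ (trans (sym (⟦name⟧ x)) (trans (cong ⟦_⟧ eq) (⟦name⟧ y)))

    W : Set
    W = U ⊎ Tree L

    to-W : H → W
    to-W x with em {P = Image p (proj₁ x)}
    ... | yes (a , _) = inj₁ a
    ... | no _        = inj₂ (name x)

    to-W-injective : Injective _≡_ _≡_ to-W
    to-W-injective {x} {y} eq with em {P = Image p (proj₁ x)} | em {P = Image p (proj₁ y)} | eq
    ... | yes (_ , pa≡x) | yes (_ , pa≡y) | refl = H-≡ (trans (sym pa≡x) pa≡y)
    ... | no _           | no _           | eq′  = name-injective (inj₂-injective eq′)

    from-W : W → H
    from-W (inj₁ a) = p a , ⟪⟫⁺ (hull-point a)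
    from-W (inj₂ t) = e (node new (t ∷ [])) , ⟪⟫⁺ (_ , hull-new t)

    from-W-injective : Injective _≡_ _≡_ from-W
    from-W-injective {inj₁ _} {inj₁ _} eq = cong inj₁ (p-injective (cong proj₁ eq))
    from-W-injective {inj₁ _} {inj₂ _} eq = contradiction (cong proj₁ eq) (p≢e _ _)
    from-W-injective {inj₂ _} {inj₁ _} eq = contradiction (sym (cong proj₁ eq)) (p≢e _ _)
    from-W-injective {inj₂ _} {inj₂ _} eq with e-injective (cong proj₁ eq)
    ... | refl = refl

    open CantorBernstein to-W from-W to-W-injective from-W-injective

    -- `to-W` and `from-W` are mutually inverse on points, so both rules defining the bijection give
    -- the same value there.
    bijection-point : ∀ a → bijection (from-W (inj₁ a)) ≡ inj₁ a
    bijection-point a with bijection-cases (from-W (inj₁ a))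
    ... | inj₂ (_ , eq) = from-W-injective eq
    ... | inj₁ (_ , eq) = trans eq to-W-point
      where
      to-W-point : to-W (from-W (inj₁ a)) ≡ inj₁ a
      to-W-point with em {P = Image p (p a)}
      ... | yes (_ , pb≡pa) = cong inj₁ (p-injective pb≡pa)
      ... | no ∉im          = contradiction (a , refl) ∉im

    κ : W → ∣ N ∣
    κ w = proj₁ (proj₁ (bijection-surjective w))

    κ-injective : Injective _≡_ _≡_ κ
    κ-injective {v} {w} eq = trans (sym (proj₂ (bijection-surjective v)))
      (trans (cong bijection (H-≡ eq)) (proj₂ (bijection-surjective w)))

    κ-point : ∀ a → κ (inj₁ a) ≡ p a
    κ-point a = cong proj₁ (bijection-injective
      (trans (proj₂ (bijection-surjective (inj₁ a))) (sym (bijection-point a))))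

    κ-image : ∀ {y} → Image ⟦_⟧ y → Image κ y
    κ-image y∈ = bijection x , cong proj₁ (bijection-injective (proj₂ (bijection-surjective (bijection x))))
      where
      x : H
      x = _ , ⟪⟫⁺ y∈

    κ-names : ∀ {n} (ws : Vec W n) → ∃[ ts ] map ⟦_⟧ ts ≡ map κ ws
    κ-names []       = [] , refl
    κ-names (w ∷ ws) = let x = proj₁ (bijection-surjective w) ; ts , eq = κ-names ws in
      name x ∷ ts , cong₂ _∷_ (⟦name⟧ x) eq

    κ-closed : ∀ {k} (f : Fun S k) ws → Image κ (Structure.fun N f (map κ ws))
    κ-closed f ws = let ts , eq = κ-names ws in
      κ-image (subst (Image ⟦_⟧ ∘ Structure.fun N f) eq (hull-fun f ts))

    κ-witness : ∀ {n} (φ : Formula S (suc n)) ws → ¬ Satisfies N (map κ ws) (`∀ φ) →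
                ∃[ w ] ¬ Satisfies N (map κ (w ∷ ws)) φ
    κ-witness φ ws ¬∀ with map κ ws | κ-names ws
    -- With the parameters named by trees, a counterexample can be found in the hull, all of which
    -- lies in the image of `κ`.
    ... | _ | ts , refl with hull-refute φ ts ¬∀
    ...   | y , y∈ , r with κ-image y∈
    ...     | w , refl = w , r

    open TarskiVaught N κ κ-injective κ-closed κ-witness public

  module _ {S : Signature} {T : Theory S} (stable : StablyInfinite T)
    {N₀ : Structure S} (N₀⊨T : N₀ ⊨ T) {U L : Set}
    (label : Label S U → L) (read : L → Maybe (Label S U)) (read-label : ∀ l → read (label l) ≡ just l)
    (new : L) (read-new : read new ≡ nothing)
    (u : U → ∣ N₀ ∣) (u-injective : Injective _≡_ _≡_ u) where

    -- Fresh elements indexed by `Tree L` are adjoined to `N₀`, and the hull is taken. The last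
    -- component allows any `j`, so that it serves both structures to be amalgamated.
    model-on-U⊎Tree : Σ[ ℐ ∈ Interpretation S (U ⊎ Tree L) ] ⟨ ℐ ⟩ ⊨ T ×
      (∀ {M : Structure S} (j : ∣ M ∣ → U) → IsEmbedding M N₀ (u ∘ j) → IsEmbedding M ⟨ ℐ ⟩ (inj₁ ∘ j))
    model-on-U⊎Tree = pullback
      , (λ φ φ∈T → elementary⁻ φ [] (extension⊨ φ φ∈T))
      -- `κ ∘ inj₁` agrees with `inclusion ∘ u`, so `κ ∘ inj₁ ∘ j` is an embedding, from which `κ`
      -- can be cancelled.
      , λ {M} j emb → ∘-cancel-isEmbedding κ-isEmbedding
          (subst (IsEmbedding M extension) (funext λ m → sym (κ-point (j m)))
            (∘-isEmbedding inclusion-isEmbedding emb))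
      where
      open Extension stable N₀⊨T (Tree L) using
        (extension; extension⊨; inclusion; inclusion-isEmbedding; fresh; fresh-injective; inclusion≢fresh)
      open Hull extension label read read-label new read-new
        (inclusion ∘ u) (u-injective ∘ injective inclusion-isEmbedding)
        fresh fresh-injective (inclusion≢fresh ∘ u)

  -- Amalgamation

  module Pushout {A M₁ M₂ : Set} (ι₁ : A → M₁) (ι₂ : A → M₂) (ι₂-injective : Injective _≡_ _≡_ ι₂) where

    -- Only the underlying maps enter, so the pushouts formed for the two reducts are the same set.
    U : Set
    U = M₁ ⊎ (Σ[ m ∈ M₂ ] ¬ Image ι₂ m)

    j₁ : M₁ → U
    j₁ = inj₁

    j₂ : M₂ → U
    j₂ m with em {P = Image ι₂ m}
    ... | yes (a , _) = inj₁ (ι₁ a)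
    ... | no m∉A      = inj₂ (m , m∉A)

    commutes : ∀ a → j₁ (ι₁ a) ≡ j₂ (ι₂ a)
    commutes a with em {P = Image ι₂ (ι₂ a)}
    ... | yes (_ , eq) = cong (inj₁ ∘ ι₁) (sym (ι₂-injective eq))
    ... | no ∉A        = contradiction (a , refl) ∉A

    common : ∀ m₁ m₂ → j₁ m₁ ≡ j₂ m₂ → Image ι₁ m₁
    common m₁ m₂ eq with em {P = Image ι₂ m₂} | eq
    ... | yes (a , _) | refl = a , refl

    module _ {M : Set} {μ₁ : M₁ → M} {μ₂ : M₂ → M}
      (μ₁-injective : Injective _≡_ _≡_ μ₁) (μ₂-injective : Injective _≡_ _≡_ μ₂)
      (agree : ∀ a → μ₁ (ι₁ a) ≡ μ₂ (ι₂ a))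
      (meet : ∀ m₁ m₂ → μ₁ m₁ ≡ μ₂ m₂ → ∃[ a ] μ₁ (ι₁ a) ≡ μ₁ m₁) where

      mediating : U → M
      mediating = [ μ₁ , μ₂ ∘ proj₁ ]

      mediating-j₂ : ∀ m → mediating (j₂ m) ≡ μ₂ m
      mediating-j₂ m with em {P = Image ι₂ m}
      ... | yes (a , eq) = trans (agree a) (cong μ₂ eq)
      ... | no _         = refl

      apart : ∀ m₁ m₂ → ¬ Image ι₂ m₂ → μ₁ m₁ ≢ μ₂ m₂
      apart m₁ m₂ m₂∉A eq = let a , eq′ = meet m₁ m₂ eq in
        m₂∉A (a , μ₂-injective (trans (sym (agree a)) (trans eq′ eq)))

      mediating-injective : Injective _≡_ _≡_ mediating
      mediating-injective {inj₁ _} {inj₁ _} eq = cong inj₁ (μ₁-injective eq)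
      mediating-injective {inj₁ _} {inj₂ (_ , ∉A)} eq = contradiction eq (apart _ _ ∉A)
      mediating-injective {inj₂ (_ , ∉A)} {inj₁ _} eq = contradiction (sym eq) (apart _ _ ∉A)
      mediating-injective {inj₂ (m , ∉A)} {inj₂ (_ , ∉A′)} eq with μ₂-injective eq
      -- Two proofs of a negation are equal by function extensionality.
      ... | refl = cong (λ n → inj₂ (m , n)) (funext λ im → contradiction im ∉A)

  -- Reducts and unions of theories.

  module _ {S S′ : Signature} (h : SignatureMorphism S S′) where
    open SignatureMorphism h

    reduct : Structure S′ → Structure S
    reduct M = record
      { Carrier = ∣ M ∣
      ; fun     = Structure.fun M ∘ onFun
      ; rel     = Structure.rel M ∘ onRel
      }

    reduct-embedding : ∀ {M N} → Embedding M N → Embedding (reduct M) (reduct N)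
    reduct-embedding μ = record
      { to        = Embedding.to μ
      ; injective = Embedding.injective μ
      ; fun-homo  = Embedding.fun-homo μ ∘ onFun
      ; rel-homo  = Embedding.rel-homo μ ∘ onRel
      }

    module _ (M : Structure S′) where

      mutual
        eval-translate : ∀ {n} (ρ : Vec ∣ M ∣ n) t → eval M ρ (translateTerm h t) ≡ eval (reduct M) ρ t
        eval-translate ρ (var i)    = refl
        eval-translate ρ (app f ts) = cong (Structure.fun M (onFun f)) (evals-translate ρ ts)

        evals-translate : ∀ {n k} (ρ : Vec ∣ M ∣ n) (ts : Vec (Term S n) k) →
                          evals M ρ (translateTerms h ts) ≡ evals (reduct M) ρ ts
        evals-translate ρ []       = refl
        evals-translate ρ (t ∷ ts) = cong₂ _∷_ (eval-translate ρ t) (evals-translate ρ ts)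

      -- As an equality of types, the connectives and the quantifier follow by congruence, and
      -- `subst` gives both directions.
      satisfies-translate : ∀ {n} (ρ : Vec ∣ M ∣ n) φ →
                            Satisfies M ρ (translate h φ) ≡ Satisfies (reduct M) ρ φ
      satisfies-translate ρ `⊥          = refl
      satisfies-translate ρ (s `≡ t)    = cong₂ _≡_ (eval-translate ρ s) (eval-translate ρ t)
      satisfies-translate ρ (atom R ts) = cong (Structure.rel M (onRel R)) (evals-translate ρ ts)
      satisfies-translate ρ (φ `⇒ ψ)    =
        cong₂ (λ P Q → P → Q) (satisfies-translate ρ φ) (satisfies-translate ρ ψ)
      satisfies-translate ρ (`∀ φ)      =
        cong (λ P → ∀ x → P x) (funext λ x → satisfies-translate (x ∷ ρ) φ)

  module _ {Σ₁ Σ₂ : Signature} where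

    infixr 5 _∪ᴵ_
    _∪ᴵ_ : ∀ {C} → Interpretation Σ₁ C → Interpretation Σ₂ C → Interpretation (Σ₁ ⊕ Σ₂) C
    ℐ ∪ᴵ 𝒥 = record
      { fun = [ Interpretation.fun ℐ , Interpretation.fun 𝒥 ]
      ; rel = [ Interpretation.rel ℐ , Interpretation.rel 𝒥 ]
      }

    module _ {T₁ : Theory Σ₁} {T₂ : Theory Σ₂} (M : Structure (Σ₁ ⊕ Σ₂)) where

      ∪ᵀ⁻ˡ : M ⊨ T₁ ∪ᵀ T₂ → reduct inl M ⊨ T₁
      ∪ᵀ⁻ˡ M⊨ φ φ∈ = subst id (satisfies-translate inl M [] φ) (M⊨ _ (left φ∈))

      ∪ᵀ⁻ʳ : M ⊨ T₁ ∪ᵀ T₂ → reduct inr M ⊨ T₂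
      ∪ᵀ⁻ʳ M⊨ φ φ∈ = subst id (satisfies-translate inr M [] φ) (M⊨ _ (right φ∈))

      ∪ᵀ⁺ : reduct inl M ⊨ T₁ → reduct inr M ⊨ T₂ → M ⊨ T₁ ∪ᵀ T₂
      ∪ᵀ⁺ ⊨₁ ⊨₂ _ (left {φ} φ∈)  = subst id (sym (satisfies-translate inl M [] φ)) (⊨₁ φ φ∈)
      ∪ᵀ⁺ ⊨₁ ⊨₂ _ (right {φ} φ∈) = subst id (sym (satisfies-translate inr M [] φ)) (⊨₂ φ φ∈)

    ⊕-embedding : ∀ {M N : Structure (Σ₁ ⊕ Σ₂)} {h : ∣ M ∣ → ∣ N ∣} →
                  IsEmbedding (reduct inl M) (reduct inl N) h →
                  IsEmbedding (reduct inr M) (reduct inr N) h → Embedding M N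
    ⊕-embedding {h = h} e₁ e₂ = record
      { to        = h
      ; injective = injective e₁
      ; fun-homo  = λ { (inj₁ f) → fun-homo e₁ f ; (inj₂ f) → fun-homo e₂ f }
      ; rel-homo  = λ { (inj₁ R) → rel-homo e₁ R ; (inj₂ R) → rel-homo e₂ R }
      }

  -- Amalgams on a prescribed carrier and their combination.

  module _ {S : Signature} {T : Theory S} (stable : StablyInfinite T) (ssa : StrongSubAmalgamation T)
    {M₁ M₂ A : Structure S} (M₁⊨ : M₁ ⊨ T) (M₂⊨ : M₂ ⊨ T)
    (ι₁ : Embedding A M₁) (ι₂ : Embedding A M₂) {L : Set} where

    open Pushout (Embedding.to ι₁) (Embedding.to ι₂) (Embedding.injective ι₂)

    abstract
      -- The condition on the intersection of the images makes the mediating map from `U` injective.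
      -- `L` is left open so that both theories can use the same carrier.
      amalgam-on-pushout : (label : Label S U → L) (read : L → Maybe (Label S U)) →
        (∀ l → read (label l) ≡ just l) → (new : L) → read new ≡ nothing →
        Σ[ ℐ ∈ Interpretation S (U ⊎ Tree L) ] ⟨ ℐ ⟩ ⊨ T ×
          IsEmbedding M₁ ⟨ ℐ ⟩ (inj₁ ∘ j₁) × IsEmbedding M₂ ⟨ ℐ ⟩ (inj₁ ∘ j₂)
      amalgam-on-pushout label read read-label new read-new =
        let N₀ , N₀⊨T , μ₁ , μ₂ , agree , meet , _ = ssa M₁⊨ M₂⊨ ι₁ ι₂
            module μ₁ = Embedding μ₁
            module μ₂ = Embedding μ₂
            shared = λ m₁ m₂ eq → meet ((m₁ , refl) , (m₂ , sym eq))
            u = mediating μ₁.injective μ₂.injective agree shared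
            ℐ , ℐ⊨T , transfer = model-on-U⊎Tree stable N₀⊨T label read read-label new read-new
              u (mediating-injective μ₁.injective μ₂.injective agree shared)
        in ℐ , ℐ⊨T , transfer j₁ (isEmbedding μ₁)
         -- `mediating ∘ j₁` is `μ₁` by definition; `j₂` decides a case, so here the equality holds
         -- only pointwise.
         , transfer j₂ (subst (IsEmbedding M₂ N₀)
             (funext λ m → sym (mediating-j₂ μ₁.injective μ₂.injective agree shared m))
             (isEmbedding μ₂))

  ∪ᵀ-strongSubAmalgamation : (Σ₁ Σ₂ : Signature) (T₁ : Theory Σ₁) (T₂ : Theory Σ₂) →
    StablyInfinite T₁ → StablyInfinite T₂ →
    StrongSubAmalgamation T₁ → StrongSubAmalgamation T₂ →
    StrongSubAmalgamation (T₁ ∪ᵀ T₂)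
  ∪ᵀ-strongSubAmalgamation Σ₁ Σ₂ T₁ T₂ stable₁ stable₂ ssa₁ ssa₂ {M₁} {M₂} M₁⊨ M₂⊨ ι₁ ι₂ =
    -- Both calls return interpretations on `U ⊎ Tree L`, and the reducts of the combined structure
    -- are `⟨ ℐ ⟩` and `⟨ 𝒥 ⟩` by definition.
    let ℐ , ℐ⊨ , e₁ , e₂ = amalgam-on-pushout stable₁ ssa₁ (∪ᵀ⁻ˡ M₁ M₁⊨) (∪ᵀ⁻ˡ M₂ M₂⊨)
          (reduct-embedding inl ι₁) (reduct-embedding inl ι₂)
          {L = L} (just ∘ inj₁) (_>>= isInj₁) (λ _ → refl) nothing refl
        𝒥 , 𝒥⊨ , e₁′ , e₂′ = amalgam-on-pushout stable₂ ssa₂ (∪ᵀ⁻ʳ M₁ M₁⊨) (∪ᵀ⁻ʳ M₂ M₂⊨)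
          (reduct-embedding inr ι₁) (reduct-embedding inr ι₂)
          {L = L} (just ∘ inj₂) (_>>= isInj₂) (λ _ → refl) nothing refl
    in ⟨ ℐ ∪ᴵ 𝒥 ⟩ , ∪ᵀ⁺ ⟨ ℐ ∪ᴵ 𝒥 ⟩ ℐ⊨ 𝒥⊨ , ⊕-embedding e₁ e₁′ , ⊕-embedding e₂ e₂′
     , (λ a → cong inj₁ (commutes a)) , meet
     , λ { (a , refl) → (_ , refl) , (_ , cong inj₁ (sym (commutes a))) }
    where
    open Pushout (Embedding.to ι₁) (Embedding.to ι₂) (Embedding.injective ι₂)

    -- Each signature reads its own summand; `nothing` is read by neither and serves both as the
    -- label `new`.
    L : Set
    L = Maybe (Label Σ₁ U ⊎ Label Σ₂ U)

    meet : ∀ {y : U ⊎ Tree L} → Image (inj₁ ∘ j₁) y × Image (inj₁ ∘ j₂) y →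
           Image (inj₁ ∘ j₁ ∘ Embedding.to ι₁) y
    meet ((m₁ , refl) , m₂ , eq) with common m₁ m₂ (sym (inj₁-injective eq))
    ... | a , refl = a , refl

mainTheorem3 : (∀ {a} → ExcludedMiddle a) →
    (∀ {a b} → Extensionality a b) →
    (Σ₁ Σ₂ : Signature) (T₁ : Theory Σ₁) (T₂ : Theory Σ₂) →
    StablyInfinite T₁ → StablyInfinite T₂ →
    StrongSubAmalgamation T₁ → StrongSubAmalgamation T₂ →
    StrongSubAmalgamation (T₁ ∪ᵀ T₂)
mainTheorem3 em funext = Classical.∪ᵀ-strongSubAmalgamation em funext
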